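{- There exists a string family on which $\delta = \Theta(\ell\sqrt{n})$. That is, there is an infinite set $\mathcal{F}$ of strings such that $\delta(w) = \Theta(\ell(w)\sqrt{n})$ for $w\in\mathcal{F}$, where $n=|w|$.
   Context: A string family is an infinite set of finite strings of unbounded length; asymptotic notation on a family refers to strings $w$ of the family with $n=|w|\to\infty$ (with constants uniform over the family). $w[i:j]$ denotes the substring of $w$ from position $i$ to position $j$ (positions start at 1). L-systems: an L-system is a tuple $(\Sigma,\varphi,\tau,s,d,n)$, where $\Sigma$ is a finite alphabet, $\varphi:\Sigma^*\to\Sigma^*$ is a non-erasing monoid endomorphism (each rule $a\to\varphi(a)$, $a\in\Sigma$, has $|\varphi(a)|\ge 1$), $\tau:\Sigma^*\to\Sigma^*$ is a coding (a morphism with $|\tau(a)|=1$ for all $a\in\Sigma$), $s\in\Sigma^+$ is the axiom, and $d\ge 0$, $n\ge 1$ are integers. It generates the unique string $\tau(\varphi^d(s))[1:n]$ of length $n$. It is always assumed that $d=n^{O(1)}$ and $|\Sigma|=n^{O(1)}$ (each value fits in an $O(\log n)$-bit word). The size of the L-system is $\sum_{a\in\Sigma}|\varphi(a)|+|s|+|\Sigma|+2$. The measure $\ell(w)$ is the size of the smallest L-system generating $w$. Substring complexity: let $P_w(k)$ be the number of distinct substrings of $w$ of length $k$. Then $\delta(w)=\max\{P_w(k)/k : 1\le k\le |w|\}$. -}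

module Defs where

open import Data.Fin using (Fin; toℕ)
import Data.Fin.Properties as Fin
open import Data.Integer using (+_)
open import Data.List as List
  using (List; []; _∷_; map; concatMap; take; drop; length; upTo; deduplicate)
open import Data.List.Extrema using (max)
open import Data.List.Extrema.Nat using () renaming (max to maxℕ; xs≤max to xs≤maxℕ)
open import Data.List.Membership.Propositional using (_∈_)
open import Data.List.Membership.Propositional.Properties
  using (∈-lookup; ∈-deduplicate⁺; ∈-map⁺)
open import Data.List.NonEmpty as List⁺ using (List⁺; _∷_; toList)
import Data.List.Properties as List
open import Data.List.Relation.Unary.All as All using (All; []; _∷_)
open import Data.List.Relation.Unary.AllPairs using (_∷_)
open import Data.List.Relation.Unary.Any using (Any; here; there; index)
open import Data.List.Relation.Unary.Any.Properties using (lookup-index)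
open import Data.List.Relation.Unary.Unique.Propositional using (Unique)
import Data.List.Relation.Unary.Unique.DecPropositional.Properties as Unique
open import Data.Nat
  using (ℕ; zero; suc; _+_; _*_; _∸_; _^_; _≤_; _<_; z≤n; s≤s; NonZero; _≟_; _≤?_)
open import Data.List.Membership.DecPropositional _≟_ using (_∈?_)
open import Data.Nat.GeneralisedArithmetic using (iterate)
open import Data.Nat.ListAction using (sum)
import Data.Nat.Properties as ℕ
open import Data.Product using (Σ; ∃; Σ-syntax; ∃-syntax; _×_; _,_; proj₁; proj₂)
open import Data.Rational as ℚ using (ℚ; 0ℚ; _/_)
import Data.Rational.Properties as ℚ
open import Data.Sum using (_⊎_; inj₁; inj₂)
open import Data.Unit using (⊤; tt)
open import Data.Vec as Vec using (Vec; []; _∷_)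
import Data.Vec.Properties as Vec
open import Function using (_∘_; id; Injective)
open import Level using (0ℓ)
open import Relation.Binary.Bundles using (DecTotalOrder)
open import Relation.Binary.PropositionalEquality
open import Relation.Nullary using (Dec; yes; no; ¬_; contradiction)
open import Relation.Nullary.Decidable using (map′; _×-dec_; _⊎-dec_; _→-dec_)
open import Relation.Unary using (Pred; Decidable)

------------------------------------------------------------------------
-- Strings and families

-- An unlimited supply of symbols; every string and every L-system uses
-- finitely many of them.

Letter : Set
Letter = ℕ

-- The measures below are only meaningful for strings of length n ≥ 1.

Str : Set
Str = List⁺ Letter

∣_∣ : Str → ℕ
∣_∣ = List⁺.length

-- Unbounded lengths already make the set infinite.

IsFamily : Pred Str 0ℓ → Set
IsFamily F = ∀ N → ∃[ w ] (F w × N ≤ ∣ w ∣)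

------------------------------------------------------------------------
-- L-systems

-- The alphabet is a finite set of letters, presented as the image of an
-- injection letter : Fin σ → Letter with σ = |Σ|.  The endomorphism φ
-- and the coding τ are given by their values on single letters.

record LSystem : Set where
  field
    σ                : ℕ
    letter           : Fin σ → Letter
    letter-injective : Injective _≡_ _≡_ letter
    φ                : Fin σ → List⁺ (Fin σ)
    τ                : Fin σ → Fin σ
    s                : List⁺ (Fin σ)
    d                : ℕ
    n                : ℕ
    n≥1              : 1 ≤ n

  φ* : List (Fin σ) → List (Fin σ)
  φ* = concatMap (toList ∘ φ)

  output : List Letter
  output = map letter (take n (map τ (iterate φ* (toList s) d)))

  size : ℕ
  size = sum (List.tabulate (List⁺.length ∘ φ)) + List⁺.length s + σ + 2

-- The first component excludes prefixes of length n that do not exist,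
-- which `take` would silently truncate.

Generates : LSystem → Str → Set
Generates L w = ∣ w ∣ ≡ n × output ≡ toList w
  where open LSystem L

-- The standing assumption d, |Σ| = n^O(1), with the exponent c explicit.

Fits : ℕ → LSystem → Set
Fits c L = d ≤ n ^ c × σ ≤ n ^ c
  where open LSystem L

HasLSystemOfSize : ℕ → Str → ℕ → Set
HasLSystemOfSize c w m = Σ[ L ∈ LSystem ] (Generates L w × Fits c L × LSystem.size L ≡ m)

IsLeast : (ℕ → Set) → ℕ → Set
IsLeast P m = P m × (∀ {k} → P k → m ≤ k)

-- ℓ is defined below, from a constructive proof that a smallest L-system
-- exists: there is at least one L-system for w, and whether there is one
-- of a given size can be decided by finite search.

private

  Searchable : {A : Set} → (A → Set) → Set₁
  Searchable {A} Q = {P : A → Set} → Decidable P → Dec (∃[ a ] (Q a × P a))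

  search-Fin : ∀ {k} → Searchable {Fin k} (λ _ → ⊤)
  search-Fin P? = map′ (λ (i , p) → i , tt , p) (λ (i , _ , p) → i , p) (Fin.any? P?)

  search-< : ∀ b → Searchable (_< b)
  search-< b P? = ℕ.anyUpTo? P? b

  search-× : ∀ {A B : Set} {Q : A → Set} {R : B → Set} →
             Searchable Q → Searchable R → Searchable (λ ((a , b) : A × B) → Q a × R b)
  search-× sQ sR P? =
    map′ (λ (a , q , b , r , p) → (a , b) , (q , r) , p)
         (λ ((a , b) , (q , r) , p) → a , q , b , r , p)
         (sQ (λ a → sR (λ b → P? (a , b))))

  search-Vec : ∀ {A : Set} {Q : A → Set} → Searchable Q →
               ∀ k → Searchable {Vec A k} (λ v → ∀ i → Q (Vec.lookup v i))
  search-Vec sQ zero P? =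
    map′ (λ p → [] , (λ ()) , p) (λ { ([] , _ , p) → p }) (P? [])
  search-Vec {Q = Q} sQ (suc k) P? =
    map′ (λ (a , q , v , qs , p) →
            a ∷ v , (λ { Fin.zero → q ; (Fin.suc i) → qs i }) , p)
         (λ { (a ∷ v , qs , p) → a , qs Fin.zero , v , qs ∘ Fin.suc , p })
         (sQ (λ a → search-Vec {Q = Q} sQ k (λ v → P? (a ∷ v))))

  search-List : ∀ {k} m → Searchable {List (Fin k)} (λ xs → length xs ≤ m)
  search-List zero P? =
    map′ (λ p → [] , z≤n , p) (λ { ([] , _ , p) → p }) (P? [])
  search-List {k} (suc m) {P} P? =
    map′ to from
      (P? [] ⊎-dec search-Fin (λ x → search-List m (λ xs → P? (x ∷ xs))))
    where
    Split : Set
    Split = P [] ⊎ (∃[ x ] (⊤ × ∃[ xs ] (length xs ≤ m × P (x ∷ xs))))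
    to : Split → ∃[ xs ] (length xs ≤ suc m × P xs)
    to (inj₁ p)                        = [] , z≤n , p
    to (inj₂ (x , _ , xs , xs≤m , p)) = x ∷ xs , s≤s xs≤m , p
    from : ∃[ xs ] (length xs ≤ suc m × P xs) → Split
    from ([]     , _        , p) = inj₁ p
    from (x ∷ xs , s≤s xs≤m , p) = inj₂ (x , tt , xs , xs≤m , p)

  search-List⁺ : ∀ {k} m → Searchable {List⁺ (Fin k)} (λ xs → List⁺.length xs ≤ m)
  search-List⁺ m P? =
    map′ (λ (x , _ , xs , xs<m , p) → x ∷ xs , xs<m , p)
         (λ { (x ∷ xs , xs<m , p) → x , tt , xs , xs<m , p })
         (search-Fin (λ x → search-shorter m (λ xs → P? (x ∷ xs))))
    where
    search-shorter : ∀ {k} m → Searchable {List (Fin k)} (λ xs → length xs < m)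
    search-shorter zero    P? = no λ { (_ , () , _) }
    search-shorter (suc m) P? =
      map′ (λ (xs , l , p) → xs , s≤s l , p) (λ { (xs , s≤s l , p) → xs , l , p })
           (search-List m P?)

  -- First-order data of an L-system with σ letters and n = |w|.

  Code : ℕ → Set
  Code σ = Vec ℕ σ × Vec (List⁺ (Fin σ)) σ × Vec (Fin σ) σ × List⁺ (Fin σ) × ℕ

  Small : ∀ σ → ℕ → ℕ → ℕ → Code σ → Set
  Small σ b m e (ls , φs , τs , s , d) =
    (∀ i → Vec.lookup ls i < b) ×
    (∀ i → List⁺.length (Vec.lookup φs i) ≤ m) ×
    (∀ (i : Fin σ) → ⊤) ×
    List⁺.length s ≤ m ×
    d < e

  search-Code : ∀ σ b m e → Searchable (Small σ b m e)
  search-Code σ b m e =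
    search-× (search-Vec (search-< b) σ)
      (search-× (search-Vec {Q = λ xs → List⁺.length xs ≤ m} (search-List⁺ m) σ)
        (search-× (search-Vec {Q = λ _ → ⊤} search-Fin σ)
          (search-× (search-List⁺ m) (search-< e))))

  InjectiveVec : ∀ {σ} → Vec ℕ σ → Set
  InjectiveVec ls = ∀ i j → Vec.lookup ls i ≡ Vec.lookup ls j → i ≡ j

  decode : ∀ {σ} (w : Str) (x : Code σ) → InjectiveVec (proj₁ x) → LSystem
  decode {σ} w (ls , φs , τs , s , d) inj = record
    { σ                = σ
    ; letter           = Vec.lookup ls
    ; letter-injective = λ {i} {j} → inj i j
    ; φ                = Vec.lookup φs
    ; τ                = Vec.lookup τs
    ; s                = s
    ; d                = d
    ; n                = ∣ w ∣
    ; n≥1              = s≤s z≤n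
    }

  Good : ℕ → Str → ℕ → ∀ {σ} → Code σ → Set
  Good c w m x = Σ[ inj ∈ InjectiveVec (proj₁ x) ]
    (let L = decode w x inj in Generates L w × Fits c L × LSystem.size L ≡ m)

  good? : ∀ c w m {σ} → Decidable (Good c w m {σ})
  good? c w m x
    with Fin.all? (λ i → Fin.all? (λ j →
           (Vec.lookup (proj₁ x) i ≟ Vec.lookup (proj₁ x) j) →-dec (i Fin.≟ j)))
  ... | no ¬inj = no (¬inj ∘ proj₁)
  ... | yes inj = map′ (inj ,_) proj₂
    (((∣ w ∣ ≟ n) ×-dec List.≡-dec _≟_ output (toList w)) ×-dec
     ((d ≤? n ^ c) ×-dec (σ ≤? n ^ c)) ×-dec
     (size ≟ m))
    where open LSystem (decode w x inj)

  -- Letters outside w can be renamed to lie in a bounded range.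

  module Rename (w : Str) {σ} (f : Fin σ → Letter) (f-inj : Injective _≡_ _≡_ f) where
    fresh : ℕ
    fresh = suc (maxℕ 0 (toList w))

    ∈⇒< : ∀ {a} → a ∈ toList w → a < fresh
    ∈⇒< a∈w = s≤s (All.lookup (xs≤maxℕ 0 (toList w)) a∈w)

    rename : Fin σ → Letter
    rename i with f i ∈? toList w
    ... | yes _ = f i
    ... | no  _ = fresh + toℕ i

    rename-∈ : ∀ i → f i ∈ toList w → rename i ≡ f i
    rename-∈ i p with f i ∈? toList w
    ... | yes _  = refl
    ... | no  ¬p = contradiction p ¬p

    rename-< : ∀ i → rename i < fresh + σ
    rename-< i with f i ∈? toList w
    ... | yes p = ℕ.<-≤-trans (∈⇒< p) (ℕ.m≤m+n fresh σ)
    ... | no  _ = ℕ.+-monoʳ-< fresh (Fin.toℕ<n i)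

    rename-inj : ∀ i j → rename i ≡ rename j → i ≡ j
    rename-inj i j eq with f i ∈? toList w | f j ∈? toList w
    ... | yes _ | yes _ = f-inj eq
    ... | yes p | no  _ = contradiction (subst (_< fresh) eq (∈⇒< p)) (ℕ.m+n≮m fresh (toℕ j))
    ... | no  _ | yes q = contradiction (subst (_< fresh) (sym eq) (∈⇒< q)) (ℕ.m+n≮m fresh (toℕ i))
    ... | no  _ | no  _ = Fin.toℕ-injective (ℕ.+-cancelˡ-≡ fresh _ _ eq)

  iterate-cong : ∀ {A : Set} {f g : A → A} → f ≗ g → ∀ x k → iterate f x k ≡ iterate g x k
  iterate-cong f≗g x zero    = refl
  iterate-cong {f = f} f≗g x (suc k) =
    trans (iterate-cong f≗g (f x) k) (cong (λ y → iterate _ y k) (f≗g x))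

  ≤-sum-tabulate : ∀ {k} (f : Fin k → ℕ) i → f i ≤ sum (List.tabulate f)
  ≤-sum-tabulate f Fin.zero    = ℕ.m≤m+n _ _
  ≤-sum-tabulate f (Fin.suc i) =
    ℕ.≤-trans (≤-sum-tabulate (f ∘ Fin.suc) i) (ℕ.m≤n+m _ (f Fin.zero))

  encode : ∀ c w {m} → HasLSystemOfSize c w m →
           let b = suc (maxℕ 0 (toList w)) in
           ∃[ σ ] (σ < suc m ×
             ∃[ x ] (Small σ (b + σ) m (suc (∣ w ∣ ^ c)) x × Good c w m x))
  encode c w {m} (L , (refl , out≡) , (d≤ , σ≤) , refl) =
    σ , s≤s σ≤size , x ,
    ( (λ i → subst (_< fresh + σ) (sym (ls≗ i)) (rename-< i))
    , (λ i → subst (λ y → List⁺.length y ≤ m) (sym (φs≗ i))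
               (ℕ.≤-trans (≤-sum-tabulate (List⁺.length ∘ φ) i) sum≤size))
    , (λ _ → tt)
    , s≤size
    , s≤s d≤) ,
    inj , (refl , out′) , (d≤ , σ≤) , size′
    where
    open LSystem L
    open Rename w letter letter-injective

    ls : Vec ℕ σ
    ls = Vec.tabulate rename
    φs : Vec (List⁺ (Fin σ)) σ
    φs = Vec.tabulate φ
    τs : Vec (Fin σ) σ
    τs = Vec.tabulate τ
    x : Code σ
    x = ls , φs , τs , s , d

    ls≗ : Vec.lookup ls ≗ rename
    ls≗ = Vec.lookup∘tabulate rename
    φs≗ : Vec.lookup φs ≗ φ
    φs≗ = Vec.lookup∘tabulate φ

    sum≤size : sum (List.tabulate (List⁺.length ∘ φ)) ≤ m
    sum≤size = ℕ.≤-trans (ℕ.m≤m+n _ _) (ℕ.≤-trans (ℕ.m≤m+n _ σ) (ℕ.m≤m+n _ 2))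
    s≤size : List⁺.length s ≤ m
    s≤size = ℕ.≤-trans (ℕ.m≤n+m _ _) (ℕ.≤-trans (ℕ.m≤m+n _ σ) (ℕ.m≤m+n _ 2))
    σ≤size : σ ≤ m
    σ≤size = ℕ.≤-trans (ℕ.m≤n+m σ _) (ℕ.m≤m+n _ 2)

    inj : InjectiveVec ls
    inj i j eq = rename-inj i j (trans (sym (ls≗ i)) (trans eq (ls≗ j)))

    v : List (Fin σ)
    v = take n (map τ (iterate φ* (toList s) d))

    v≡ : take n (map (Vec.lookup τs) (iterate (LSystem.φ* (decode w x inj)) (toList s) d)) ≡ v
    v≡ = cong (take n) (trans
      (List.map-cong (Vec.lookup∘tabulate τ) _)
      (cong (map τ) (iterate-cong (List.concatMap-cong (cong toList ∘ φs≗)) (toList s) d)))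

    out′ : LSystem.output (decode w x inj) ≡ toList w
    out′ = trans (cong (map (Vec.lookup ls)) v≡) (trans (List.map-cong-local
      (All.tabulate λ {i} i∈v → trans (ls≗ i)
        (rename-∈ i (subst (letter i ∈_) out≡ (∈-map⁺ letter i∈v))))) out≡)

    size′ : LSystem.size (decode w x inj) ≡ m
    size′ = cong (λ t → t + List⁺.length s + σ + 2)
      (cong sum (List.tabulate-cong (cong List⁺.length ∘ φs≗)))

  hasLSystemOfSize? : ∀ c w → Decidable (HasLSystemOfSize c w)
  hasLSystemOfSize? c w m =
    map′ (λ { (σ , _ , x , _ , inj , g) → decode w x inj , g })
         (encode c w)
         (search-< (suc m) (λ σ → search-Code σ _ m _ (good? c w m)))

  module Trivial (c : ℕ) {{_ : NonZero c}} (w : Str) where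

    letters : List Letter
    letters = deduplicate _≟_ (toList w)

    lookup-inj : ∀ {xs : List Letter} → Unique xs → ∀ i j →
                 List.lookup xs i ≡ List.lookup xs j → i ≡ j
    lookup-inj (_ ∷ _)  Fin.zero    Fin.zero    _  = refl
    lookup-inj (x∉ ∷ _) Fin.zero    (Fin.suc j) eq = contradiction eq (All.lookup x∉ (∈-lookup j))
    lookup-inj (x∉ ∷ _) (Fin.suc i) Fin.zero    eq =
      contradiction (sym eq) (All.lookup x∉ (∈-lookup i))
    lookup-inj (_ ∷ u)  (Fin.suc i) (Fin.suc j) eq = cong Fin.suc (lookup-inj u i j eq)

    indices : ∀ xs → All (_∈ letters) xs →
              Σ[ is ∈ List (Fin (length letters)) ] (map (List.lookup letters) is ≡ xs)
    indices []       []       = [] , refl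
    indices (_ ∷ xs) (p ∷ ps) =
      let is , eq = indices xs ps in index p ∷ is , cong₂ _∷_ (sym (lookup-index p)) eq

    indices⁺ : Σ[ is ∈ List⁺ (Fin (length letters)) ]
                 (map (List.lookup letters) (toList is) ≡ toList w)
    indices⁺ with indices (toList w) (All.tabulate (∈-deduplicate⁺ _≟_))
    ... | i ∷ is , eq = i ∷ is , eq

    L : LSystem
    L = record
      { σ                = length letters
      ; letter           = List.lookup letters
      ; letter-injective = lookup-inj (Unique.deduplicate-! _≟_ (toList w)) _ _
      ; φ                = List⁺.[_]
      ; τ                = id
      ; s                = proj₁ indices⁺
      ; d                = 0
      ; n                = ∣ w ∣
      ; n≥1              = s≤s z≤n
      }
    open LSystem L

    output≡ : output ≡ toList w
    output≡ = begin
      map letter (take ∣ w ∣ (map id (toList s)))  ≡⟨ cong (map letter ∘ take ∣ w ∣) (List.map-id (toList s)) ⟩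
      map letter (take ∣ w ∣ (toList s))           ≡⟨ cong (map letter) (List.take-all ∣ w ∣ (toList s) (ℕ.≤-reflexive len)) ⟩
      map letter (toList s)                        ≡⟨ proj₂ indices⁺ ⟩
      toList w                                     ∎
      where
      open ≡-Reasoning
      len : length (toList s) ≡ ∣ w ∣
      len = trans (sym (List.length-map letter (toList s))) (cong length (proj₂ indices⁺))

    fits : Fits c L
    fits = z≤n , ℕ.≤-trans (List.length-deduplicate _≟_ (toList w)) (n≤n^c c)
      where
      n≤n^c : ∀ c {{_ : NonZero c}} → ∣ w ∣ ≤ ∣ w ∣ ^ c
      n≤n^c (suc k) = ℕ.m≤m*n ∣ w ∣ (∣ w ∣ ^ k) {{ℕ.m^n≢0 ∣ w ∣ k}}

    has : HasLSystemOfSize c w size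
    has = L , (refl , output≡) , fits , refl

  least : ∀ {P : ℕ → Set} → Decidable P → ∀ {m} → P m → ∃ (IsLeast P)
  least P? {zero}  p = zero , p , λ _ → z≤n
  least {P} P? {suc m} p with P? 0
  ... | yes p₀ = zero , p₀ , λ _ → z≤n
  ... | no ¬p₀ with least {P ∘ suc} (P? ∘ suc) p
  ...   | k , pk , k≤ = suc k , pk , minimal
    where
    minimal : ∀ {j} → P j → suc k ≤ j
    minimal {zero}  p₀ = contradiction p₀ ¬p₀
    minimal {suc _} q  = s≤s (k≤ q)

abstract
  smallestLSystem : ∀ c {{_ : NonZero c}} w → ∃ (IsLeast (HasLSystemOfSize c w))
  smallestLSystem c w = least (hasLSystemOfSize? c w) (Trivial.has c w)

-- ℓ c w is the size of the smallest L-system generating w, among those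
-- with d, |Σ| ≤ n^c.

ℓ : (c : ℕ) {{_ : NonZero c}} → Str → ℕ
ℓ c w = proj₁ (smallestLSystem c w)

ℓ-isLeast : ∀ c {{_ : NonZero c}} w → IsLeast (HasLSystemOfSize c w) (ℓ c w)
ℓ-isLeast c w = proj₂ (smallestLSystem c w)

------------------------------------------------------------------------
-- Substring complexity

-- Position i of `upTo` is the 0-based start of the substring; for
-- 1 ≤ k ≤ |w| there are |w| - k + 1 of them.

substrings : Str → ℕ → List (List Letter)
substrings w k = map (λ i → take k (drop i (toList w))) (upTo (suc ∣ w ∣ ∸ k))

P : Str → ℕ → ℕ
P w k = length (deduplicate (List.≡-dec _≟_) (substrings w k))

-- The list is non-empty and consists of positive numbers, so the base
-- value 0 does not affect the maximum.

δ : Str → ℚ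
δ w = max (DecTotalOrder.totalOrder ℚ.≤-decTotalOrder) 0ℚ (map (λ k → + P w (suc k) / suc k) (upTo ∣ w ∣))

------------------------------------------------------------------------
-- Asymptotics

fromℕ : ℕ → ℚ
fromℕ k = + k / 1

-- f = Θ(g √n) on F.  For nonnegative rationals p and q, p ≤ q √n means
-- p² ≤ q² n, so the two bounds  a g(w) √n ≤ f(w) ≤ b g(w) √n  (with f ≥ 0)
-- are stated in squared form.  Rational constants a, b lose no
-- generality, as positive real ones can be decreased resp. increased.

_=Θ[_]_√n : (Str → ℚ) → Pred Str 0ℓ → (Str → ℕ) → Set
f =Θ[ F ] g √n =
  ∃[ a ] ∃[ b ] ∃[ n₀ ] (0ℚ ℚ.< a × 0ℚ ℚ.< b ×
    (∀ w → F w → n₀ ≤ ∣ w ∣ →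
      let n = fromℕ ∣ w ∣
          l = a ℚ.* fromℕ (g w)
          u = b ℚ.* fromℕ (g w)
      in l ℚ.* l ℚ.* n ℚ.≤ f w ℚ.* f w × f w ℚ.* f w ℚ.≤ u ℚ.* u ℚ.* n))

{-# OPTIONS --safe #-}

-- The L-system a → ab, b → bc, c → c with axiom a has constant size and
-- generates, at depth d, the string a·b·bc·bcc⋯bc^{d-1} of length Θ(d²).
--
-- Upper bound: a window of length k starting after the first k blocks
-- contains at most one b, so P(k) = O(k²).  Since also P(k) ≤ n, this gives
-- P(k)² = O(k² n).
--
-- Lower bound: for d = k = 3m, the windows c^p b c^q b⋯ with p < m ≤ q < 2m
-- are m² distinct substrings of length k, while n = Θ(m²).

module Submission where

open import Defs
open import Data.Fin using (Fin; zero; suc; toℕ)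
import Data.Fin.Properties as Fin
open import Data.Integer as ℤ using (+_)
import Data.Integer.Properties as ℤ
open import Data.List
  using (List; []; _∷_; _++_; cartesianProduct; drop; length; map; replicate; take; upTo)
open import Data.List.Extrema using (argmax-all; xs≤max)
open import Data.List.Membership.Propositional using (_∈_)
open import Data.List.Membership.Propositional.Properties
open import Data.List.NonEmpty using (List⁺; _∷_; toList)
open import Data.List.Properties
open import Data.List.Relation.Binary.Subset.Propositional using (_⊆_)
import Data.List.Relation.Unary.All as All
import Data.List.Relation.Unary.All.Properties as All
open import Data.List.Relation.Unary.AllPairs using (_∷_)
open import Data.List.Relation.Unary.Any using (here; there)
open import Data.List.Relation.Unary.Unique.Propositional using (Unique)
import Data.List.Relation.Unary.Unique.DecPropositional.Properties as DecUnique
import Data.List.Relation.Unary.Unique.Propositional.Properties as Unique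
open import Data.Nat
  using (ℕ; zero; suc; pred; NonZero; _+_; _*_; _∸_; _^_; _≤_; _<_; z≤n; s≤s; _≟_; _≤?_; _<?_)
open import Data.Nat.GeneralisedArithmetic using (iterate)
open import Data.Nat.Properties hiding (_≟_; _≤?_; _<?_)
open import Data.Nat.Tactic.RingSolver using (solve-∀)
open import Data.Product using (∃-syntax; _×_; _,_; proj₂)
open import Data.Rational as ℚ using (ℚ; 0ℚ; _/_; toℚᵘ)
import Data.Rational.Properties as ℚ
open import Data.Rational.Unnormalised as ℚᵘ using (mkℚᵘ)
import Data.Rational.Unnormalised.Properties as ℚᵘ
open import Data.Sum using (inj₁; inj₂)
open import Function using (_∘_; id)
open import Level using (Level)
open import Relation.Binary.Bundles using (DecTotalOrder)
open import Relation.Binary.PropositionalEquality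
open import Relation.Nullary using (yes; no; contradiction)

-- Lists: inclusion, lengths and runs.

private
  variable
    a : Level
    A B : Set a

-- Pigeonhole: delete one occurrence of the head of `xs` from `ys`; by uniqueness the tail of `xs`
-- still lies in what remains.
Unique-⊆⇒length≤ : {xs ys : List A} → Unique xs → xs ⊆ ys → length xs ≤ length ys
Unique-⊆⇒length≤ {xs = []} _ _ = z≤n
Unique-⊆⇒length≤ {xs = x ∷ xs} (x∉ ∷ u) xs⊆
  with as , bs , refl ← ∈-∃++ (xs⊆ (here refl)) = begin
    suc (length xs)               ≤⟨ s≤s (Unique-⊆⇒length≤ u xs⊆′) ⟩
    suc (length (as ++ bs))       ≡⟨ cong suc (length-++ as) ⟩
    suc (length as + length bs)   ≡⟨ +-suc _ _ ⟨
    length as + suc (length bs)   ≡⟨ length-++ as ⟨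
    length (as ++ x ∷ bs)         ∎
  where
  open ≤-Reasoning
  xs⊆′ : xs ⊆ as ++ bs
  xs⊆′ z∈ with ∈-++⁻ as (xs⊆ (there z∈))
  ... | inj₁ z∈as           = ∈-++⁺ˡ z∈as
  ... | inj₂ (here refl)    = contradiction refl (All.lookup x∉ z∈)
  ... | inj₂ (there z∈bs)   = ∈-++⁺ʳ as z∈bs

drop-length-++ : ∀ (xs : List A) {ys} j → drop (length xs + j) (xs ++ ys) ≡ drop j ys
drop-length-++ []       j = refl
drop-length-++ (_ ∷ xs) j = drop-length-++ xs j

replicate-+ : ∀ m n (x : A) → replicate (m + n) x ≡ replicate m x ++ replicate n x
replicate-+ zero    n x = refl
replicate-+ (suc m) n x = cong (x ∷_) (replicate-+ m n x)

length-cartesianProduct : ∀ (xs : List A) (ys : List B) →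
                          length (cartesianProduct xs ys) ≡ length xs * length ys
length-cartesianProduct []       ys = refl
length-cartesianProduct (x ∷ xs) ys = trans (length-++ (map (x ,_) ys))
  (cong₂ _+_ (length-map (x ,_) ys) (length-cartesianProduct xs ys))

-- Estimating the number of distinct substrings.

-- Upper bounds on `P` thus need only a list of candidates, which may contain repetitions and
-- non-substrings.
P≤length : ∀ w k {ys} → substrings w k ⊆ ys → P w k ≤ length ys
P≤length w k ⊆ys = Unique-⊆⇒length≤ (DecUnique.deduplicate-! (≡-dec _≟_) (substrings w k))
  (⊆ys ∘ ∈-deduplicate⁻ (≡-dec _≟_) (substrings w k))

length≤P : ∀ w k {ys} → Unique ys → ys ⊆ substrings w k → length ys ≤ P w k
length≤P w k u ys⊆ = Unique-⊆⇒length≤ u (∈-deduplicate⁺ (≡-dec _≟_) ∘ ys⊆)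

P≤∣w∣ : ∀ w k → P w (suc k) ≤ ∣ w ∣
P≤∣w∣ w k = begin
  P w (suc k)                     ≤⟨ length-deduplicate (≡-dec _≟_) (substrings w (suc k)) ⟩
  length (substrings w (suc k))   ≡⟨ trans (length-map _ (upTo (∣ w ∣ ∸ k))) (length-upTo (∣ w ∣ ∸ k)) ⟩
  ∣ w ∣ ∸ k                       ≤⟨ m∸n≤m ∣ w ∣ k ⟩
  ∣ w ∣                           ∎
  where open ≤-Reasoning

-- Turns a factorisation of `w` into the starting position `length u`, the form in which
-- `substrings` enumerates its elements.
suffix⇒∈-substrings : ∀ w {u v k} → toList w ≡ u ++ v → k ≤ length v → take k v ∈ substrings w k
suffix⇒∈-substrings w@(_ ∷ _) {u} {v} {k} w≡ k≤ =
  subst (_∈ substrings w k) (cong (take k) drop≡) (∈-map⁺ _ (∈-upTo⁺ u<))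
  where
  drop≡ : drop (length u) (toList w) ≡ v
  drop≡ = trans (cong₂ drop (sym (+-identityʳ (length u))) w≡) (drop-length-++ u 0)
  u< : length u < suc ∣ w ∣ ∸ k
  u< = m+n≤o⇒m≤o∸n (suc (length u)) (s≤s (begin
    length u + k          ≤⟨ +-monoʳ-≤ (length u) k≤ ⟩
    length u + length v   ≡⟨ length-++ u ⟨
    length (u ++ v)       ≡⟨ cong length w≡ ⟨
    ∣ w ∣                 ∎))
    where open ≤-Reasoning

-- Staircases of growing blocks.

-- The word x y^lo x y^(lo+1) ⋯ with n blocks. A variable `lo` makes every suffix that starts at a
-- block have the same form; a generic letter type serves both `Fin 3` and `Letter`.
blocks : A → A → ℕ → ℕ → List A
blocks x y lo zero    = []
blocks x y lo (suc n) = x ∷ replicate lo y ++ blocks x y (suc lo) n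

staircase : A → A → A → ℕ → List⁺ A
staircase x y z n = x ∷ blocks y z 0 n

map-blocks : ∀ (f : A → B) x y lo n → map f (blocks x y lo n) ≡ blocks (f x) (f y) lo n
map-blocks f x y lo zero    = refl
map-blocks f x y lo (suc n) = cong (f x ∷_)
  (trans (map-++ f (replicate lo y) _)
         (cong₂ _++_ (map-replicate f lo y) (map-blocks f x y (suc lo) n)))

module _ {A : Set a} {x y : A} where

  blocks-++ : ∀ lo m n → blocks x y lo (m + n) ≡ blocks x y lo m ++ blocks x y (m + lo) n
  blocks-++ lo zero    n = refl
  blocks-++ lo (suc m) n = cong (x ∷_) (begin
    replicate lo y ++ blocks x y (suc lo) (m + n)
      ≡⟨ cong (replicate lo y ++_) (blocks-++ (suc lo) m n) ⟩
    replicate lo y ++ (blocks x y (suc lo) m ++ blocks x y (m + suc lo) n)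
      ≡⟨ ++-assoc (replicate lo y) _ _ ⟨
    (replicate lo y ++ blocks x y (suc lo) m) ++ blocks x y (m + suc lo) n
      ≡⟨ cong (λ h → (replicate lo y ++ blocks x y (suc lo) m) ++ blocks x y h n) (+-suc m lo) ⟩
    (replicate lo y ++ blocks x y (suc lo) m) ++ blocks x y (suc (m + lo)) n ∎)
    where open ≡-Reasoning

  length-blocks-suc : ∀ lo n → length (blocks x y lo (suc n)) ≡ suc lo + length (blocks x y (suc lo) n)
  length-blocks-suc lo n = cong suc
    (trans (length-++ (replicate lo y)) (cong (_+ length (blocks x y (suc lo) n)) (length-replicate lo)))

  -- Each of the n blocks has length at most lo + n.
  length-blocks-≤ : ∀ lo n → length (blocks x y lo n) ≤ n * (lo + n)
  length-blocks-≤ lo zero    = z≤n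
  length-blocks-≤ lo (suc n) = begin
    length (blocks x y lo (suc n))            ≡⟨ length-blocks-suc lo n ⟩
    suc lo + length (blocks x y (suc lo) n)   ≤⟨ +-mono-≤ (s≤s (m≤m+n lo n)) (length-blocks-≤ (suc lo) n) ⟩
    suc (lo + n) + n * suc (lo + n)           ≡⟨ cong (suc n *_) (+-suc lo n) ⟨
    suc n * (lo + suc n)                      ∎
    where open ≤-Reasoning

  -- The last block alone has this length; the induction discards the earlier ones.
  length-blocks-≥ : ∀ lo n → lo + suc n ≤ length (blocks x y lo (suc n))
  length-blocks-≥ lo zero    = ≤-reflexive (sym (trans (length-blocks-suc lo 0)
    (trans (+-identityʳ _) (+-comm 1 lo))))
  length-blocks-≥ lo (suc n) = begin
    lo + suc (suc n)                                ≡⟨ +-suc lo (suc n) ⟩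
    suc lo + suc n                                  ≤⟨ length-blocks-≥ (suc lo) n ⟩
    length (blocks x y (suc lo) (suc n))            ≤⟨ m≤n+m _ (suc lo) ⟩
    suc lo + length (blocks x y (suc lo) (suc n))   ≡⟨ length-blocks-suc lo (suc n) ⟨
    length (blocks x y lo (suc (suc n)))            ∎
    where open ≤-Reasoning

  atMostOne : ℕ → List (List A)
  atMostOne k = replicate k y ∷ map (λ i → replicate i y ++ x ∷ replicate (k ∸ suc i) y) (upTo k)

  length-atMostOne : ∀ k → length (atMostOne k) ≡ suc k
  length-atMostOne k = cong suc (trans (length-map _ (upTo k)) (length-upTo k))

  take-replicate-++ : ∀ k m {zs : List A} → k ≤ m → take k (replicate m y ++ zs) ≡ replicate k y
  take-replicate-++ zero    m       _         = refl
  take-replicate-++ (suc k) (suc m) (s≤s k≤m) = cong (y ∷_) (take-replicate-++ k m k≤m)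

  take-run : ∀ p n {zs : List A} →
             take (p + suc n) (replicate p y ++ x ∷ zs) ≡ replicate p y ++ x ∷ take n zs
  take-run zero    n = refl
  take-run (suc p) n = cong (y ∷_) (take-run p n)

  -- If k exceeds p, the prefix reaches the first `x`, and the run of lo ≥ k letters `y` behind it
  -- outlasts the remaining k - p - 1 positions.
  prefix∈atMostOne : ∀ {k} p lo n → k ≤ lo → k ≤ length (replicate p y ++ blocks x y lo n) →
                  take k (replicate p y ++ blocks x y lo n) ∈ atMostOne k
  prefix∈atMostOne {k} p lo n k≤lo k≤len with k ≤? p
  ... | yes k≤p = here (take-replicate-++ k p k≤p)
  -- Without blocks the list has length p < k, too short for a prefix of length k.
  prefix∈atMostOne {k} p lo zero k≤lo k≤len | no k≰p = contradiction
    (≤-trans k≤len (≤-reflexive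
      (trans (cong length (++-identityʳ (replicate p y))) (length-replicate p)))) k≰p
  prefix∈atMostOne {k} p lo (suc n) k≤lo k≤len | no k≰p =
    there (subst (_∈ map _ (upTo k)) (sym eq) (∈-map⁺ _ (∈-upTo⁺ p<k)))
    where
    open ≡-Reasoning
    p<k : p < k
    p<k = ≰⇒> k≰p
    t : ℕ
    t = k ∸ suc p
    eq : take k (replicate p y ++ blocks x y lo (suc n)) ≡ replicate p y ++ x ∷ replicate t y
    eq = begin
      take k (replicate p y ++ blocks x y lo (suc n))
        ≡⟨ cong (λ h → take h (replicate p y ++ blocks x y lo (suc n)))
             (trans (sym (m+[n∸m]≡n p<k)) (sym (+-suc p t))) ⟩
      take (p + suc t) (replicate p y ++ blocks x y lo (suc n))
        ≡⟨ take-run p t ⟩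
      replicate p y ++ x ∷ take t (replicate lo y ++ blocks x y (suc lo) n)
        ≡⟨ cong (λ h → replicate p y ++ x ∷ h)
             (take-replicate-++ t lo (≤-trans (m∸n≤m k (suc p)) k≤lo)) ⟩
      replicate p y ++ x ∷ replicate t y ∎

  -- The partial run `p` carries the induction on `j`: dropping a letter either shortens the current
  -- run or removes an `x`, and then the run `lo` behind it becomes the current one.
  window∈atMostOne : ∀ {k} j p lo n → k ≤ lo → j + k ≤ length (replicate p y ++ blocks x y lo n) →
                  take k (drop j (replicate p y ++ blocks x y lo n)) ∈ atMostOne k
  window∈atMostOne zero    p       lo n       k≤lo len≥       = prefix∈atMostOne p lo n k≤lo len≥
  window∈atMostOne (suc j) (suc p) lo n       k≤lo (s≤s len≥) = window∈atMostOne j p lo n k≤lo len≥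
  window∈atMostOne (suc j) zero    lo (suc n) k≤lo (s≤s len≥) =
    window∈atMostOne j lo (suc lo) n (m≤n⇒m≤1+n k≤lo) len≥

  run-injective : x ≢ y → ∀ p p′ {zs zs′} → replicate p y ++ x ∷ zs ≡ replicate p′ y ++ x ∷ zs′ →
                  p ≡ p′ × zs ≡ zs′
  run-injective x≢y zero    zero     eq = refl , ∷-injectiveʳ eq
  run-injective x≢y zero    (suc p′) eq = contradiction (∷-injectiveˡ eq) x≢y
  run-injective x≢y (suc p) zero     eq = contradiction (sym (∷-injectiveˡ eq)) x≢y
  run-injective x≢y (suc p) (suc p′) eq =
    let p≡ , zs≡ = run-injective x≢y p p′ (∷-injectiveʳ eq) in cong suc p≡ , zs≡

-- The words and the upper bound on their substring counts.

word : ℕ → Str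
word = staircase 0 1 2

∣word∣-≤ : ∀ d → ∣ word d ∣ ≤ 1 + d * d
∣word∣-≤ d = s≤s (length-blocks-≤ 0 d)

∣word∣-> : ∀ d → d < ∣ word d ∣
∣word∣-> zero    = s≤s z≤n
∣word∣-> (suc d) = s≤s (length-blocks-≥ 0 d)

-- Windows starting in `pre`, the first letter and k blocks, are counted by position, at most 1 +
-- k². Later ones lie in `post`, whose runs have length at least k, so they are among k + 1 words.
P-word-≤ : ∀ d k → k ≤ d → P (word d) k ≤ 1 + k * k + suc k
P-word-≤ d k k≤d = ≤-trans (P≤length (word d) k ⊆cands) (begin
  length cands
    ≡⟨ trans (length-++ early) (cong₂ _+_
         (trans (length-map win (upTo (length pre))) (length-upTo (length pre)))
         (length-atMostOne {x = 1} {2} k)) ⟩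
  length pre + suc k
    ≤⟨ +-monoˡ-≤ (suc k) (∣word∣-≤ k) ⟩
  1 + k * k + suc k ∎)
  where
  open ≤-Reasoning
  pre post : List ℕ
  pre = 0 ∷ blocks 1 2 0 k
  post = blocks 1 2 (k + 0) (d ∸ k)
  win : ℕ → List ℕ
  win i = take k (drop i (toList (word d)))
  early cands : List (List ℕ)
  early = map win (upTo (length pre))
  cands = early ++ atMostOne {x = 1} {2} k
  split : toList (word d) ≡ pre ++ post
  split = cong (0 ∷_) (trans (cong (blocks 1 2 0) (sym (m+[n∸m]≡n k≤d))) (blocks-++ 0 k (d ∸ k)))
  ⊆cands : substrings (word d) k ⊆ cands
  ⊆cands z∈ with i , i∈ , refl ← ∈-map⁻ win z∈ with i <? length pre
  ... | yes i<pre = ∈-++⁺ˡ (∈-map⁺ win (∈-upTo⁺ i<pre))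
  ... | no  i≮pre = ∈-++⁺ʳ early (subst (_∈ atMostOne k) (cong (take k) (sym drop≡))
    (window∈atMostOne j 0 (k + 0) (d ∸ k) (m≤m+n k 0) (+-cancelˡ-≤ (length pre) _ _ (begin
      length pre + (j + k)       ≡⟨ +-assoc (length pre) j k ⟨
      length pre + j + k         ≡⟨ cong (_+ k) pre+j ⟩
      i + k                      ≤⟨ ≤-pred (m≤o∸n⇒m+n≤o (suc i) k≤ (∈-upTo⁻ i∈)) ⟩
      ∣ word d ∣                 ≡⟨ cong length split ⟩
      length (pre ++ post)       ≡⟨ length-++ pre ⟩
      length pre + length post   ∎))))
    where
    k≤ : k ≤ suc ∣ word d ∣
    k≤ = ≤-trans k≤d (m≤n⇒m≤1+n (<⇒≤ (∣word∣-> d)))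
    j : ℕ
    j = i ∸ length pre
    pre+j : length pre + j ≡ i
    pre+j = m+[n∸m]≡n (≮⇒≥ i≮pre)
    drop≡ : drop i (toList (word d)) ≡ drop j post
    drop≡ = trans (cong₂ drop (sym pre+j) split) (drop-length-++ pre j)

-- The two factors are bounded differently, one by 4k′² and the other by the length of the word.
P²-word-≤ : ∀ d k → let k′ = suc k in
            P (word d) k′ * P (word d) k′ ≤ 4 * (k′ * k′) * ∣ word d ∣
P²-word-≤ d k = *-mono-≤ P≤4k² (P≤∣w∣ (word d) k)
  where
  open ≤-Reasoning
  slack : ∀ k → 1 + suc k * suc k + suc (suc k) + (3 * (k * k) + 5 * k) ≡ 4 * (suc k * suc k)
  slack = solve-∀
  P≤4k² : P (word d) (suc k) ≤ 4 * (suc k * suc k)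
  P≤4k² = ≤-trans P≤ (≤-trans (m≤m+n _ _) (≤-reflexive (slack k)))
    where
    P≤ : P (word d) (suc k) ≤ 1 + suc k * suc k + suc (suc k)
    P≤ with suc k ≤? d
    ... | yes k≤d = P-word-≤ d (suc k) k≤d
    -- For windows longer than d the whole word is already of length at most 1 + d².
    ... | no  k≰d = begin
      P (word d) (suc k)   ≤⟨ P≤∣w∣ (word d) k ⟩
      ∣ word d ∣           ≤⟨ ∣word∣-≤ d ⟩
      1 + d * d            ≤⟨ s≤s (*-mono-≤ (≰⇒≥ k≰d) (≰⇒≥ k≰d)) ⟩
      1 + suc k * suc k    ≤⟨ m≤m+n _ _ ⟩
      1 + suc k * suc k + suc (suc k) ∎

-- Lower bound: quadratically many substrings of one length.

module ManyFactors (m : ℕ) where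

  -- Serves as number of blocks and as window length. With p ≤ m and q ≤ 2m + 1, both runs and both
  -- letters `1` take p + q + 2 ≤ 3m + 3 positions, so they just fit.
  d : ℕ
  d = 3 * suc m

  -- The windows c^p b c^q b⋯ with q = m + 1 + r, written with both leading
  -- runs exposed so that (p , r) ↦ factor (p , r) is injective on all of
  -- ℕ × ℕ, although it yields substrings only for p , r ≤ m.
  factor : ℕ × ℕ → List ℕ
  factor (p , r) = replicate p 2 ++ 1 ∷ replicate q 2 ++ 1 ∷
      take (d ∸ (p + q + 2)) (replicate (suc q) 2 ++ blocks 1 2 (suc (suc q)) (d ∸ (2 + q)))
    where q = suc (m + r)

  -- The first `1` reveals p, the second one q and hence r.
  factor-injective : ∀ {s t} → factor s ≡ factor t → s ≡ t
  factor-injective {p , r} {p′ , r′} eq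
    with refl , eq′ ← run-injective (λ ()) p p′ eq
    with q≡ , _ ← run-injective (λ ()) (suc (m + r)) (suc (m + r′)) eq′
    = cong (p ,_) (+-cancelˡ-≡ m r r′ (suc-injective q≡))

  -- The window starts inside the block with run q′ = q - 1, where exactly p letters `2` remain;
  -- this is possible as p ≤ m ≤ q′. The blocks with runs q and q + 1 follow.
  factor∈ : ∀ {p r} → p ≤ m → r ≤ m → factor (p , r) ∈ substrings (word d) d
  factor∈ {p} {r} p≤m r≤m = subst (_∈ substrings (word d) d) take≡
    (suffix⇒∈-substrings (word d) {u = pre} split d≤)
    where
    q′ q e t : ℕ
    q′ = m + r
    q = suc q′
    -- The number of blocks after the one with run q + 1.
    e = d ∸ (2 + q)
    t = d ∸ (p + q + 2)
    pre suf : List ℕ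
    pre = (0 ∷ blocks 1 2 0 q′) ++ 1 ∷ replicate (q′ ∸ p) 2
    suf = replicate p 2 ++ blocks 1 2 q (2 + e)
    arith₁ : ∀ m → m + (m + (m + 3)) ≡ 3 * suc m
    arith₁ = solve-∀
    arith₂ : ∀ p m r → p + suc (m + r) + 2 ≡ p + (r + (m + 3))
    arith₂ = solve-∀
    arith₃ : ∀ p q t → p + q + 2 + t ≡ p + suc (q + suc t)
    arith₃ = solve-∀
    pq≤d : p + q + 2 ≤ d
    pq≤d = begin
      p + q + 2           ≡⟨ arith₂ p m r ⟩
      p + (r + (m + 3))   ≤⟨ +-mono-≤ p≤m (+-monoˡ-≤ (m + 3) r≤m) ⟩
      m + (m + (m + 3))   ≡⟨ arith₁ m ⟩
      d                   ∎
      where open ≤-Reasoning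
    d≡ : d ≡ p + suc (q + suc t)
    d≡ = trans (sym (m+[n∸m]≡n pq≤d)) (arith₃ p q t)
    q+e : 2 + q + e ≡ d
    q+e = m+[n∸m]≡n (≤-trans (m≤n+m (2 + q) p) (≤-trans (≤-reflexive
      (trans (cong (λ h → p + h) (+-comm 2 q)) (sym (+-assoc p q 2)))) pq≤d))
    q′+e : q′ + (3 + e) ≡ d
    q′+e = trans (arith₄ q′ e) q+e
      where
      arith₄ : ∀ q e → q + (3 + e) ≡ 2 + suc q + e
      arith₄ = solve-∀
    open ≡-Reasoning
    split : toList (word d) ≡ pre ++ suf
    split = cong (0 ∷_) (begin
      blocks 1 2 0 d
        ≡⟨ cong (blocks 1 2 0) q′+e ⟨
      blocks 1 2 0 (q′ + (3 + e))
        ≡⟨ blocks-++ 0 q′ (3 + e) ⟩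
      blocks 1 2 0 q′ ++ blocks 1 2 (q′ + 0) (3 + e)
        ≡⟨ cong (λ h → blocks 1 2 0 q′ ++ blocks 1 2 h (3 + e)) (+-identityʳ q′) ⟩
      blocks 1 2 0 q′ ++ 1 ∷ replicate q′ 2 ++ blocks 1 2 q (2 + e)
        ≡⟨ cong (λ h → blocks 1 2 0 q′ ++ 1 ∷ h ++ blocks 1 2 q (2 + e))
             (trans (cong (λ h → replicate h 2) (sym (m∸n+n≡m (≤-trans p≤m (m≤m+n m r)))))
                    (replicate-+ (q′ ∸ p) p 2)) ⟩
      blocks 1 2 0 q′ ++ 1 ∷ (replicate (q′ ∸ p) 2 ++ replicate p 2) ++ blocks 1 2 q (2 + e)
        ≡⟨ cong (λ h → blocks 1 2 0 q′ ++ 1 ∷ h) (++-assoc (replicate (q′ ∸ p) 2) _ _) ⟩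
      blocks 1 2 0 q′ ++ 1 ∷ replicate (q′ ∸ p) 2 ++ suf
        ≡⟨ ++-assoc (blocks 1 2 0 q′) _ _ ⟨
      (blocks 1 2 0 q′ ++ 1 ∷ replicate (q′ ∸ p) 2) ++ suf ∎)
    take≡ : take d suf ≡ factor (p , r)
    take≡ = begin
      take d suf
        ≡⟨ cong (λ h → take h suf) d≡ ⟩
      take (p + suc (q + suc t)) suf
        ≡⟨ take-run p (q + suc t) ⟩
      replicate p 2 ++ 1 ∷ take (q + suc t) (replicate q 2 ++ blocks 1 2 (suc q) (1 + e))
        ≡⟨ cong (λ h → replicate p 2 ++ 1 ∷ h) (take-run q t) ⟩
      factor (p , r) ∎
    -- The last block of the word, with run d - 1, already has length d.
    d≤ : d ≤ length suf
    d≤ = ≤-trans (≤-reflexive (trans (sym q+e) (arith₅ q e)))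
      (≤-trans (length-blocks-≥ q (suc e))
      (≤-trans (m≤n+m _ (length (replicate p 2)))
               (≤-reflexive (sym (length-++ (replicate p 2))))))
      where
      arith₅ : ∀ q e → 2 + q + e ≡ q + (2 + e)
      arith₅ = solve-∀

  factors : List (List ℕ)
  factors = map factor (cartesianProduct (upTo (suc m)) (upTo (suc m)))

  length-factors : length factors ≡ suc m * suc m
  length-factors = trans (length-map factor (cartesianProduct (upTo (suc m)) (upTo (suc m))))
    (trans (length-cartesianProduct (upTo (suc m)) (upTo (suc m)))
           (cong₂ _*_ (length-upTo (suc m)) (length-upTo (suc m))))

  m²≤P : suc m * suc m ≤ P (word d) d
  m²≤P = ≤-trans (≤-reflexive (sym length-factors)) (length≤P (word d) d
    (Unique.map⁺ factor-injective
      (Unique.cartesianProduct⁺ (Unique.upTo⁺ (suc m)) (Unique.upTo⁺ (suc m))))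
    ⊆substrings)
    where
    ⊆substrings : factors ⊆ substrings (word d) d
    ⊆substrings z∈ with (p , r) , pr∈ , refl ← ∈-map⁻ factor z∈ =
      let p∈ , r∈ = ∈-cartesianProduct⁻ (upTo (suc m)) (upTo (suc m)) pr∈
      in factor∈ (≤-pred (∈-upTo⁻ p∈)) (≤-pred (∈-upTo⁻ r∈))

  P²≥ : ∣ word d ∣ * (d * d) ≤ 100 * (P (word d) d * P (word d) d)
  P²≥ = begin
    ∣ word d ∣ * (d * d)                        ≤⟨ *-monoˡ-≤ (d * d) (∣word∣-≤ d) ⟩
    (1 + d * d) * (d * d)                       ≤⟨ ≤-trans (m≤m+n _ _) (≤-reflexive (slack m)) ⟩
    100 * ((suc m * suc m) * (suc m * suc m))   ≤⟨ *-monoʳ-≤ 100 (*-mono-≤ m²≤P m²≤P) ⟩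
    100 * (P (word d) d * P (word d) d)         ∎
    where
    open ≤-Reasoning
    -- With M = m + 1 the left side (1 + 9M²) · 9M² is at most 90M⁴; the bound is rounded up to 100
    -- = 10², whose root is rational.
    slack : ∀ m → (1 + 3 * suc m * (3 * suc m)) * (3 * suc m * (3 * suc m))
                  + (suc m * suc m) * (10 + 38 * m + 19 * (m * m))
                  ≡ 100 * ((suc m * suc m) * (suc m * suc m))
    slack = solve-∀

-- The constant-size L-system.

module System (d : ℕ) where

  system : LSystem
  system = record
    { σ                = 3
    ; letter           = toℕ
    ; letter-injective = Fin.toℕ-injective
    ; φ                = λ { zero → zero ∷ suc zero ∷ []
                           ; (suc zero) → suc zero ∷ suc (suc zero) ∷ []
                           ; (suc (suc zero)) → suc (suc zero) ∷ [] }
    ; τ                = id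
    ; s                = zero ∷ []
    ; d                = d
    ; n                = ∣ word d ∣
    ; n≥1              = s≤s z≤n
    }
  open LSystem system hiding (d)

  b c : Fin 3
  b = suc zero
  c = suc (suc zero)

  φ*-replicate : ∀ n zs → φ* (replicate n c ++ zs) ≡ replicate n c ++ φ* zs
  φ*-replicate zero    zs = refl
  φ*-replicate (suc n) zs = cong (c ∷_) (φ*-replicate n zs)

  -- The image b ↦ bc adds one `c` to each block, and every `c` is fixed.
  φ*-blocks : ∀ lo n → φ* (blocks b c lo n) ≡ blocks b c (suc lo) n
  φ*-blocks lo zero    = refl
  φ*-blocks lo (suc n) = cong (λ h → b ∷ c ∷ h)
    (trans (φ*-replicate lo _) (cong (replicate lo c ++_) (φ*-blocks (suc lo) n)))

  -- One application lengthens every block and, through a ↦ ab, inserts a new block with empty run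
  -- in front. `iterate` acts on its starting value first, hence the general n.
  iterate-φ* : ∀ k n → iterate φ* (toList (staircase zero b c n)) k ≡
                       toList (staircase zero b c (k + n))
  iterate-φ* zero    n = refl
  iterate-φ* (suc k) n = trans
    (cong (λ h → iterate φ* (zero ∷ b ∷ h) k) (φ*-blocks 0 n))
    (trans (iterate-φ* k (suc n)) (cong (toList ∘ staircase zero b c) (+-suc k n)))

  generates : Generates system (word d)
  generates = refl , (begin
    map toℕ (take ∣ word d ∣ (map id (iterate φ* (toList s) d)))
      ≡⟨ cong (map toℕ ∘ take ∣ word d ∣) 
           (trans (map-id _)
             (trans (iterate-φ* d 0) (cong (toList ∘ staircase zero b c) (+-identityʳ d)))) ⟩
    map toℕ (take ∣ word d ∣ w′)
      ≡⟨ cong (map toℕ) (take-all ∣ word d ∣ w′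
           (≤-reflexive (trans (sym (length-map toℕ w′)) (cong length map≡)))) ⟩
    map toℕ w′
      ≡⟨ map≡ ⟩
    toList (word d) ∎)
    where
    open ≡-Reasoning
    w′ : List (Fin 3)
    w′ = toList (staircase zero b c d)
    map≡ : map toℕ w′ ≡ toList (word d)
    map≡ = cong (0 ∷_) (map-blocks toℕ b c 0 d)

  -- The size is (2 + 2 + 1) + 1 + 3 + 2. The bound 2 ≤ d makes the word long enough for its length
  -- to bound the alphabet size 3.
  ℓ≤11 : 2 ≤ d → ∀ c {{_ : NonZero c}} → ℓ c (word d) ≤ 11
  ℓ≤11 2≤d c@(suc c′) = proj₂ (ℓ-isLeast c (word d))
    ( system , generates
    , (≤-trans (<⇒≤ (∣word∣-> d)) n≤n^c , ≤-trans (≤-trans (s≤s 2≤d) (∣word∣-> d)) n≤n^c)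
    , refl)
    where
    n≤n^c : ∣ word d ∣ ≤ ∣ word d ∣ ^ c
    n≤n^c = m≤m*n ∣ word d ∣ (∣ word d ∣ ^ c′) {{m^n≢0 ∣ word d ∣ c′}}

ℓ≥1 : ∀ c {{_ : NonZero c}} w → 1 ≤ ℓ c w
ℓ≥1 c w with ((L , _ , _ , size≡) , _) ← ℓ-isLeast c w =
  subst (1 ≤_) size≡ (≤-trans (s≤s z≤n) (m≤n+m 2 _))

-- From natural-number inequalities to rational bounds on δ².

-- Passing to unnormalised rationals leaves plain cross-multiplication, with no common factors to
-- cancel.
/-mono-≤ : ∀ {a b c d} → a * suc d ≤ c * suc b → + a / suc b ℚ.≤ + c / suc d
/-mono-≤ {a} {b} {c} {d} le = ℚ.toℚᵘ-cancel-≤ (begin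
  toℚᵘ (+ a / suc b)   ≃⟨ ℚ.toℚᵘ-fromℚᵘ (mkℚᵘ (+ a) b) ⟩
  mkℚᵘ (+ a) b         ≤⟨ ℚᵘ.*≤* (subst₂ ℤ._≤_ (ℤ.pos-* a (suc d)) (ℤ.pos-* c (suc b)) (ℤ.+≤+ le)) ⟩
  mkℚᵘ (+ c) d         ≃⟨ ℚ.toℚᵘ-fromℚᵘ (mkℚᵘ (+ c) d) ⟨
  toℚᵘ (+ c / suc d)   ∎)
  where open ℚᵘ.≤-Reasoning

/-* : ∀ a b c d → (+ a / suc b) ℚ.* (+ c / suc d) ≡ + (a * c) / (suc b * suc d)
/-* a b c d = ℚ.toℚᵘ-injective (begin
  toℚᵘ ((+ a / suc b) ℚ.* (+ c / suc d))
    ≈⟨ ℚ.toℚᵘ-homo-* (+ a / suc b) (+ c / suc d) ⟩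
  toℚᵘ (+ a / suc b) ℚᵘ.* toℚᵘ (+ c / suc d)
    ≈⟨ ℚᵘ.*-cong (ℚ.toℚᵘ-fromℚᵘ (mkℚᵘ (+ a) b)) (ℚ.toℚᵘ-fromℚᵘ (mkℚᵘ (+ c) d)) ⟩
  mkℚᵘ (+ a) b ℚᵘ.* mkℚᵘ (+ c) d
    ≡⟨ cong (λ h → mkℚᵘ h (d + b * suc d)) (sym (ℤ.pos-* a c)) ⟩
  mkℚᵘ (+ (a * c)) (d + b * suc d)
    ≈⟨ ℚ.toℚᵘ-fromℚᵘ (mkℚᵘ (+ (a * c)) (d + b * suc d)) ⟨
  toℚᵘ (+ (a * c) / (suc b * suc d))            ∎)
  where open ℚᵘ.≃-Reasoning

coefficient²*n : ∀ α β g n → let l = (+ α / suc β) ℚ.* fromℕ g in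
  l ℚ.* l ℚ.* fromℕ n ≡ + (α * g * (α * g) * n) / (suc β * 1 * (suc β * 1) * 1)
coefficient²*n α β g n = trans
  (cong (ℚ._* fromℕ n) (trans (cong₂ ℚ._*_ (/-* α β g 0) (/-* α β g 0))
                              (/-* (α * g) (β * 1) (α * g) (β * 1))))
  (/-* (α * g * (α * g)) (β * 1 + β * 1 * suc (β * 1)) n 0)

private
  ℚ-order = DecTotalOrder.totalOrder ℚ.≤-decTotalOrder

  ratio : Str → ℕ → ℚ
  ratio w k = + P w (suc k) / suc k

-- The maximum inherits any property shared by the default value and all ratios. Choosing a property
-- of the square bypasses monotonicity of squaring.
δ²-≤ : ∀ w {C D} → (∀ k → P w (suc k) * P w (suc k) * suc D ≤ C * (suc k * suc k)) →
       δ w ℚ.* δ w ℚ.≤ + C / suc D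
δ²-≤ w {C} {D} P²≤ = argmax-all ℚ-order id {P = λ q → q ℚ.* q ℚ.≤ + C / suc D}
  -- The default value `0ℚ` of the maximum.
  (/-mono-≤ {0} {0} {C} {D} z≤n)
  (All.map⁺ (All.universal (λ k → subst (ℚ._≤ + C / suc D)
    (sym (/-* (P w (suc k)) k (P w (suc k)) k))
    (/-mono-≤ {P w (suc k) * P w (suc k)} {k + k * suc k} {C} {D} (P²≤ k))) (upTo ∣ w ∣)))

-- The single ratio for length k + 1 is a lower bound for the maximum.
δ²-≥ : ∀ w {C D} k → k < ∣ w ∣ → C * (suc k * suc k) ≤ P w (suc k) * P w (suc k) * suc D →
       + C / suc D ℚ.≤ δ w ℚ.* δ w
δ²-≥ w {C} {D} k k< ≤P² = begin
  + C / suc D                   ≤⟨ /-mono-≤ {C} {D} {p * p} {k + k * suc k} ≤P² ⟩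
  + (p * p) / (suc k * suc k)   ≡⟨ /-* p k p k ⟨
  q ℚ.* q                       ≤⟨ ℚ.*-monoʳ-≤-nonNeg q {{q≥0}} q≤δ ⟩
  δ w ℚ.* q                     ≤⟨ ℚ.*-monoˡ-≤-nonNeg (δ w) {{δ≥0}} q≤δ ⟩
  δ w ℚ.* δ w                   ∎
  where
  open ℚ.≤-Reasoning
  p : ℕ
  p = P w (suc k)
  q : ℚ
  q = ratio w k
  q≥0 : ℚ.NonNegative q
  q≥0 = ℚ.normalize-nonNeg p (suc k)
  q≤δ : q ℚ.≤ δ w
  q≤δ = All.lookup (xs≤max ℚ-order 0ℚ (map (ratio w) (upTo ∣ w ∣))) (∈-map⁺ (ratio w) (∈-upTo⁺ k<))
  δ≥0 : ℚ.NonNegative (δ w)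
  δ≥0 = ℚ.nonNegative (ℚ.≤-trans (ℚ.nonNegative⁻¹ q {{q≥0}}) q≤δ)

-- The factor 2 is the root of the 4 in the hypothesis; g² ≥ 1 lets g² be inserted on the right.
δ≤2g√n : ∀ w g → 1 ≤ g →
         (∀ k → P w (suc k) * P w (suc k) ≤ 4 * (suc k * suc k) * ∣ w ∣) →
         let u = (+ 2 / 1) ℚ.* fromℕ g in δ w ℚ.* δ w ℚ.≤ u ℚ.* u ℚ.* fromℕ ∣ w ∣
δ≤2g√n w g 1≤g P²≤ = subst (δ w ℚ.* δ w ℚ.≤_) (sym (coefficient²*n 2 0 g ∣ w ∣))
  (δ²-≤ w {2 * g * (2 * g) * ∣ w ∣} {0} λ k → begin
    P w (suc k) * P w (suc k) * 1              ≤⟨ *-mono-≤ (P²≤ k) (*-mono-≤ 1≤g 1≤g) ⟩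
    4 * (suc k * suc k) * ∣ w ∣ * (g * g)      ≡⟨ rearrange g (suc k * suc k) ∣ w ∣ ⟩
    2 * g * (2 * g) * ∣ w ∣ * (suc k * suc k)  ∎)
  where
  open ≤-Reasoning
  rearrange : ∀ g k n → 4 * k * n * (g * g) ≡ 2 * g * (2 * g) * n * k
  rearrange = solve-∀

g√n/110≤δ : ∀ w g k → g ≤ 11 → k < ∣ w ∣ →
            ∣ w ∣ * (suc k * suc k) ≤ 100 * (P w (suc k) * P w (suc k)) →
            let l = (+ 1 / 110) ℚ.* fromℕ g in l ℚ.* l ℚ.* fromℕ ∣ w ∣ ℚ.≤ δ w ℚ.* δ w
g√n/110≤δ w g k g≤11 k< n≤ = subst (ℚ._≤ δ w ℚ.* δ w) (sym (coefficient²*n 1 109 g ∣ w ∣))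
  -- Denominators are stored as predecessors: 12099 + 1 = 110² = 11² · 100, from g ≤ 11 and the
  -- constant 100.
  (δ²-≥ w {1 * g * (1 * g) * ∣ w ∣} {12099} k k< (begin
    1 * g * (1 * g) * ∣ w ∣ * (suc k * suc k)          ≡⟨ rearrange₁ g ∣ w ∣ (suc k * suc k) ⟩
    g * g * (∣ w ∣ * (suc k * suc k))                  ≤⟨ *-mono-≤ (*-mono-≤ g≤11 g≤11) n≤ ⟩
    11 * 11 * (100 * (P w (suc k) * P w (suc k)))      ≡⟨ rearrange₂ (P w (suc k) * P w (suc k)) ⟩
    P w (suc k) * P w (suc k) * 12100                  ∎))
  where
  open ≤-Reasoning
  rearrange₁ : ∀ g n k → 1 * g * (1 * g) * n * k ≡ g * g * (n * k)
  rearrange₁ = solve-∀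
  rearrange₂ : ∀ x → 11 * 11 * (100 * x) ≡ x * 12100
  rearrange₂ x = trans (sym (*-assoc (11 * 11) 100 x)) (*-comm 12100 x)

lemma1 : ∃[ F ] (IsFamily F × (∀ (c : ℕ) {{_ : NonZero c}} → δ =Θ[ F ] ℓ c √n))
lemma1 = F , family , λ c → + 1 / 110 , + 2 / 1 , 0 , ℚ.positive⁻¹ _ , ℚ.positive⁻¹ _ ,
  λ { w (m , refl) _ →
      -- Lengths are indexed as `suc k`, so this index selects windows of length 3(m + 1).
      g√n/110≤δ w (ℓ c w) (pred (3 * suc m))
        (System.ℓ≤11 (3 * suc m) (≤-trans (s≤s (s≤s z≤n)) (m≤m*n 3 (suc m))) c)
        (<⇒≤ (∣word∣-> (3 * suc m))) (ManyFactors.P²≥ m)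
    , δ≤2g√n w (ℓ c w) (ℓ≥1 c w) (P²-word-≤ (3 * suc m)) }
  where
  F : Str → Set
  F w = ∃[ m ] w ≡ word (3 * suc m)

  family : IsFamily F
  family N = word (3 * suc N) , (N , refl) ,
    ≤-trans (n≤1+n N) (≤-trans (m≤n*m (suc N) 3) (<⇒≤ (∣word∣-> (3 * suc N))))
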